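{- Let $n\ge 1$ be an integer. For $i=1,2,\ldots,n$ let $\tau_i=(i,\,n+1)\in\mathfrak S_{n+1}$ be the transposition exchanging $i$ and $n+1$, and let $X_n=\mathrm{Cay}(\mathfrak S_{n+1},\{\tau_1,\tau_2,\ldots,\tau_n\})$. Then $X_n$ is an $\mathfrak S_n$-cover of the complete graph $K_{n+1}$.
   Context: $\mathfrak S_m$ is the symmetric group on $\{1,\dots,m\}$; permutations are composed as functions, $(\xi\tau)(j)=\xi(\tau(j))$. The Cayley graph $\mathrm{Cay}(G,S)$ (with $S=S^{ -1}$, $1\notin S$) is the simple undirected graph with vertex set $G$ in which $\xi$ and $\eta$ are adjacent iff $\eta=\xi s$ for some $s\in S$. Cover: for finite simple graphs $\tilde X$ and $X$, $\tilde X$ is a cover of $X$ if there is a surjective graph morphism $p:\tilde X\to X$ such that for every vertex $\tilde v$ of $\tilde X$, $p$ induces a bijection from the set of edges incident to $\tilde v$ to the set of edges incident to $p(\tilde v)$. Galois cover: a cover $p:\tilde X\to X$ is Galois if there is a group $G$ acting on $\tilde X$ (by graph automorphisms) that acts freely and transitively on each fiber $p^{ -1}(w)$, $w\in V(X)$, and such that the quotient graph $\tilde X/G$ is isomorphic to $X$. Then $G$ is called the Galois group and $\tilde X$ is called a $G$-cover of $X$ (so "$\mathfrak S_n$-cover" means that the Galois group is isomorphic to $\mathfrak S_n$). The quotient graph $\tilde X/G$ has the $G$-orbits of vertices as vertices, two orbits being adjacent iff some representatives are adjacent in $\tilde X$. -}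

module Defs where

open import Level using (0ℓ)
open import Algebra.Bundles using (Group)
open import Algebra.Morphism.Structures using (module GroupMorphisms)
import Algebra.Properties.Group as GroupProperties
open import Data.Nat.Base using (ℕ; zero; suc; _*_)
open import Data.Fin.Base using (Fin; zero; suc; inject₁; fromℕ; punchIn; punchOut; combine; remQuot)
open import Data.Fin.Properties
  using (_≟_; fromℕ≢inject₁; punchIn-injective; punchIn-punchOut; remQuot-combine; combine-remQuot)
open import Data.Fin.Permutation
  using (Permutation′; _⟨$⟩ʳ_; _⟨$⟩ˡ_; inverseˡ; inverseʳ; _∘ₚ_; flip; transpose; insert; remove
        ; insert-punchIn; punchIn-permute; insert-remove)
  renaming (id to idₚ; _≈_ to _≈ₚ_)
import Data.Fin.Permutation.Components as Components
open import Data.Product.Base using (Σ; ∃; _×_; _,_; proj₁; proj₂; uncurry)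
open import Data.Sum.Base using (_⊎_; inj₁; inj₂)
open import Function.Bundles using (Func; Inverse)
open import Function.Definitions using (Bijective; Surjective)
import Function.Construct.Identity as Identity
open import Relation.Binary.Bundles using (Setoid)
open import Relation.Binary.Core using (Rel)
open import Relation.Binary.Definitions using (Irreflexive; Symmetric; _Respects₂_)
open import Relation.Binary.PropositionalEquality
  using (_≡_; _≢_; refl; sym; trans; cong; cong₂; setoid; ≢-sym)
open import Relation.Nullary.Decidable.Core using (yes; no)
open import Relation.Nullary.Negation.Core using (contradiction)
open import Relation.Unary using (Pred) renaming (_∈_ to _∈ₚ_; _∉_ to _∉ₚ_)

Finite : Setoid 0ℓ 0ℓ → Set
Finite A = ∃ λ k → Inverse (setoid (Fin k)) A

-- Vertices form a setoid so that quotient graphs, and graphs whose vertices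
-- are permutations up to pointwise equality, are graphs. Loops are allowed
-- here because a quotient graph may have them.
record Graph : Set₁ where
  infix 4 _~_
  field
    vertices : Setoid 0ℓ 0ℓ
  open Setoid vertices public
    using (_≈_) renaming (Carrier to V; refl to ≈-refl; sym to ≈-sym; trans to ≈-trans)
  field
    _~_    : Rel V 0ℓ
    ~-resp : _~_ Respects₂ _≈_
    ~-sym  : Symmetric _~_

record FiniteSimpleGraph : Set₁ where
  field
    graph : Graph
  open Graph graph public
  field
    ~-irrefl : Irreflexive _≈_ _~_
    finite   : Finite vertices

record GraphMorphism (X Y : Graph) : Set where
  private
    module X = Graph X
    module Y = Graph Y
  field
    vertexMap : Func X.vertices Y.vertices
  open Func vertexMap public using (to) renaming (cong to to-cong)
  field
    ~-pres : ∀ {u v} → u X.~ v → to u Y.~ to v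

record GraphIsomorphism (X Y : Graph) : Set where
  private
    module X = Graph X
    module Y = Graph Y
  field
    vertexMap : Inverse X.vertices Y.vertices
  open Inverse vertexMap public
  field
    ~-pres    : ∀ {u v} → u X.~ v → to u Y.~ to v
    ~-reflect : ∀ {u v} → to u Y.~ to v → u X.~ v

-- Edges are unordered: `_≈ₑ_` identifies an edge with its reversal.
module Edges (X : Graph) where
  open Graph X

  record Edge : Set where
    constructor edge
    field
      end₁ end₂ : V
      joined    : end₁ ~ end₂

  open Edge public

  infix 4 _≈ₑ_
  _≈ₑ_ : Rel Edge 0ℓ
  e ≈ₑ f = (end₁ e ≈ end₁ f × end₂ e ≈ end₂ f) ⊎ (end₁ e ≈ end₂ f × end₂ e ≈ end₁ f)

  Incident : V → Edge → Set
  Incident v e = v ≈ end₁ e ⊎ v ≈ end₂ e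

  IncidentEdge : V → Set
  IncidentEdge v = Σ Edge (Incident v)

  infix 4 _≈ᵢ_
  _≈ᵢ_ : ∀ {v} → Rel (IncidentEdge v) 0ℓ
  (e , _) ≈ᵢ (f , _) = e ≈ₑ f

open Edges using (edge; IncidentEdge; _≈ᵢ_)

mapIncident : ∀ {X Y} (p : GraphMorphism X Y) (v : Graph.V X) →
              IncidentEdge X v → IncidentEdge Y (GraphMorphism.to p v)
mapIncident {X} {Y} p v (edge a b a~b , i) = edge (to a) (to b) (~-pres a~b) , incident i
  where
  open GraphMorphism p
  module X = Graph X
  module Y = Graph Y
  incident : v X.≈ a ⊎ v X.≈ b → to v Y.≈ to a ⊎ to v Y.≈ to b
  incident (inj₁ v≈a) = inj₁ (to-cong v≈a)
  incident (inj₂ v≈b) = inj₂ (to-cong v≈b)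

-- Surjectivity of p is on vertices; on edges it then follows from `edge-bijection`.
record Cover (X̃ X : FiniteSimpleGraph) : Set where
  private
    module X̃ = FiniteSimpleGraph X̃
    module X = FiniteSimpleGraph X
  field
    p              : GraphMorphism X̃.graph X.graph
  open GraphMorphism p public using (to)
  field
    p-surjective   : Surjective X̃._≈_ X._≈_ to
    edge-bijection : ∀ ṽ → Bijective (_≈ᵢ_ X̃.graph) (_≈ᵢ_ X.graph) (mapIncident p ṽ)

record GraphAction (G : Group 0ℓ 0ℓ) (X : Graph) : Set where
  private
    module G = Group G
  open Graph X
  infixr 8 _·_
  field
    automorphism : G.Carrier → GraphIsomorphism X X
  _·_ : G.Carrier → V → V
  g · v = GraphIsomorphism.to (automorphism g) v
  field
    ·-congˡ    : ∀ {g h} v → g G.≈ h → g · v ≈ h · v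
    ·-identity : ∀ v → G.ε · v ≈ v
    ·-assoc    : ∀ g h v → (g G.∙ h) · v ≈ g · (h · v)
  ·-congʳ : ∀ g {u v} → u ≈ v → g · u ≈ g · v
  ·-congʳ g = GraphIsomorphism.to-cong (automorphism g)

module _ {G : Group 0ℓ 0ℓ} {X : Graph} (A : GraphAction G X) where
  private
    module G = Group G
  open Graph X
  open GraphAction A

  SameOrbit : Rel V 0ℓ
  SameOrbit u v = ∃ λ g → g · u ≈ v

  private
    sameOrbit-refl : ∀ {u v} → u ≈ v → SameOrbit u v
    sameOrbit-refl u≈v = G.ε , ≈-trans (·-identity _) u≈v

    sameOrbit-sym : ∀ {u v} → SameOrbit u v → SameOrbit v u
    sameOrbit-sym {u} {v} (g , gu≈v) = g G.⁻¹ ,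
      ≈-trans (·-congʳ (g G.⁻¹) (≈-sym gu≈v))
      (≈-trans (≈-sym (·-assoc (g G.⁻¹) g u))
      (≈-trans (·-congˡ u (G.inverseˡ g)) (·-identity u)))

    sameOrbit-trans : ∀ {u v w} → SameOrbit u v → SameOrbit v w → SameOrbit u w
    sameOrbit-trans {u} (g , gu≈v) (h , hv≈w) = h G.∙ g ,
      ≈-trans (·-assoc h g u) (≈-trans (·-congʳ h gu≈v) hv≈w)

  quotient : Graph
  quotient = record
    { vertices = record
      { Carrier       = V
      ; _≈_           = SameOrbit
      ; isEquivalence = record
        { refl  = sameOrbit-refl ≈-refl
        ; sym   = sameOrbit-sym
        ; trans = sameOrbit-trans
        }
      }
    ; _~_    = λ u v → ∃ λ u′ → ∃ λ v′ → SameOrbit u u′ × SameOrbit v v′ × u′ ~ v′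
    ; ~-resp = (λ { v≈w (u′ , v′ , ou , ov , a) → u′ , v′ , ou , sameOrbit-trans (sameOrbit-sym v≈w) ov , a })
             , (λ { u≈w (u′ , v′ , ou , ov , a) → u′ , v′ , sameOrbit-trans (sameOrbit-sym u≈w) ou , ov , a })
    ; ~-sym  = λ { (u′ , v′ , ou , ov , a) → v′ , u′ , ov , ou , ~-sym a }
    }

record GaloisAction {X̃ X : FiniteSimpleGraph} (C : Cover X̃ X) (G : Group 0ℓ 0ℓ) : Set where
  private
    module X̃ = FiniteSimpleGraph X̃
    module X = FiniteSimpleGraph X
    module G = Group G
  open Cover C
  field
    action : GraphAction G X̃.graph
  open GraphAction action
  InFiber : X.V → X̃.V → Set
  InFiber w ṽ = to ṽ X.≈ w
  field
    preserves-fibers : ∀ w g ṽ → InFiber w ṽ → InFiber w (g · ṽ)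
    free             : ∀ w g ṽ → InFiber w ṽ → g · ṽ X̃.≈ ṽ → g G.≈ G.ε
    transitive       : ∀ w ũ ṽ → InFiber w ũ → InFiber w ṽ → ∃ λ g → g · ũ X̃.≈ ṽ
    quotient≅X       : GraphIsomorphism (quotient action) X.graph

record GaloisCover (X̃ X : FiniteSimpleGraph) : Set₁ where
  field
    cover        : Cover X̃ X
    galoisGroup  : Group 0ℓ 0ℓ
    galoisAction : GaloisAction cover galoisGroup

infix 4 _≅ᴳ_
_≅ᴳ_ : Group 0ℓ 0ℓ → Group 0ℓ 0ℓ → Set
G ≅ᴳ H = Σ (Group.Carrier G → Group.Carrier H) IsGroupIsomorphism
  where open GroupMorphisms (Group.rawGroup G) (Group.rawGroup H)

-- G is the Galois group only up to isomorphism.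
_IsA_-CoverOf_ : FiniteSimpleGraph → Group 0ℓ 0ℓ → FiniteSimpleGraph → Set₁
X̃ IsA G -CoverOf X = Σ (GaloisCover X̃ X) λ C → GaloisCover.galoisGroup C ≅ᴳ G

record ConnectionSet (G : Group 0ℓ 0ℓ) : Set₁ where
  open Group G
  field
    S         : Pred Carrier 0ℓ
    S-resp    : ∀ {s t} → s ≈ t → s ∈ₚ S → t ∈ₚ S
    ⁻¹-closed : ∀ {s} → s ∈ₚ S → s ⁻¹ ∈ₚ S
    ε∉S       : ε ∉ₚ S

Cay : (G : Group 0ℓ 0ℓ) → Finite (Group.setoid G) → ConnectionSet G → FiniteSimpleGraph
Cay G G-finite connectionSet = record
  { graph = record
    { vertices = G.setoid
    ; _~_      = λ ξ η → ∃ λ s → s ∈ₚ S × η ≈ ξ ∙ s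
    ; ~-resp   = (λ { η≈η′ (s , s∈S , e) → s , s∈S , G.trans (G.sym η≈η′) e })
               , (λ { ξ≈ξ′ (s , s∈S , e) → s , s∈S , G.trans e (G.∙-congʳ ξ≈ξ′) })
    ; ~-sym    = λ { {ξ} {η} (s , s∈S , e) → s G.⁻¹ , ⁻¹-closed s∈S ,
                   G.trans (G.sym (G.identityʳ ξ))
                   (G.trans (G.∙-congˡ (G.sym (G.inverseʳ s)))
                   (G.trans (G.sym (G.assoc ξ s (s G.⁻¹))) (G.∙-congʳ (G.sym e)))) }
    }
  ; ~-irrefl = λ { {ξ} {η} ξ≈η (s , s∈S , e) →
      ε∉S (S-resp (identityʳ-unique ξ s (G.trans (G.sym e) (G.sym ξ≈η))) s∈S) }
  ; finite   = G-finite
  }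
  where
  module G = Group G
  open G using (_≈_; _∙_)
  open GroupProperties G using (identityʳ-unique)
  open ConnectionSet connectionSet

-- `_∘ₚ_` composes diagrammatically, so (ξ ∙ τ)(j) = ξ(τ(j)).
𝔖 : ℕ → Group 0ℓ 0ℓ
𝔖 m = record
  { Carrier = Permutation′ m
  ; _≈_     = _≈ₚ_
  ; _∙_     = λ ξ τ → τ ∘ₚ ξ
  ; ε       = idₚ
  ; _⁻¹     = flip
  ; isGroup = record
    { isMonoid = record
      { isSemigroup = record
        { isMagma = record
          { isEquivalence = record
            { refl  = λ _ → refl
            ; sym   = λ e i → sym (e i)
            ; trans = λ e f i → trans (e i) (f i)
            }
          ; ∙-cong = λ {ξ} {ξ′} {τ} {τ′} e f i → trans (e (τ ⟨$⟩ʳ i)) (cong (ξ′ ⟨$⟩ʳ_) (f i))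
          }
        ; assoc = λ _ _ _ _ → refl
        }
      ; identity = (λ _ _ → refl) , (λ _ _ → refl)
      }
    ; inverse = (λ ξ _ → inverseˡ ξ) , (λ ξ _ → inverseʳ ξ)
    ; ⁻¹-cong = λ {ξ} {τ} e i →
        trans (sym (inverseˡ τ))
              (cong (τ ⟨$⟩ˡ_) (trans (sym (e (ξ ⟨$⟩ˡ i))) (inverseʳ ξ)))
    }
  }

private
  insert-cong : ∀ {m} i j {π ρ : Permutation′ m} → π ≈ₚ ρ → insert i j π ≈ₚ insert i j ρ
  insert-cong i j π≈ρ k with i ≟ k
  ... | yes _   = refl
  ... | no  i≢k = cong (punchIn j) (π≈ρ (punchOut i≢k))

  insert-self : ∀ {m} i j (π : Permutation′ m) → insert i j π ⟨$⟩ʳ i ≡ j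
  insert-self i j π with i ≟ i
  ... | yes _   = refl
  ... | no  i≢i = contradiction refl i≢i

  remove-unique : ∀ {m} i (π : Permutation′ (suc m)) (ρ : Permutation′ m) →
                  (∀ k → π ⟨$⟩ʳ punchIn i k ≡ punchIn (π ⟨$⟩ʳ i) (ρ ⟨$⟩ʳ k)) → remove i π ≈ₚ ρ
  remove-unique i π ρ e k = punchIn-injective (π ⟨$⟩ʳ i) _ _
    (trans (sym (punchIn-permute π i k)) (e k))

-- There are m! permutations, determined by the image of the first element
-- and a permutation of the remaining ones.
𝔖-finite : ∀ m → Finite (Group.setoid (𝔖 m))
𝔖-finite zero = 1 , record
  { to        = λ _ → idₚ
  ; from      = λ _ → zero
  ; to-cong   = λ _ ()
  ; from-cong = λ _ → refl
  ; inverse   = (λ _ ()) , λ { {zero} _ → refl }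
  }
𝔖-finite (suc m) with k , enum ← 𝔖-finite m = suc m * k , record
  { to        = to
  ; from      = from
  ; to-cong   = λ { refl _ → refl }
  ; from-cong = λ {π} {ρ} → from-cong {π} {ρ}
  ; inverse   = (λ { {π} refl → to-from π })
              , (λ {i} {π} π≈ → trans (from-cong {π} {to i} π≈) (from-to i))
  }
  where
  module E = Inverse enum

  build : Fin (suc m) × Fin k → Permutation′ (suc m)
  build (j , i) = insert zero j (E.to i)

  to : Fin (suc m * k) → Permutation′ (suc m)
  to i = build (remQuot k i)

  from : Permutation′ (suc m) → Fin (suc m * k)
  from π = combine (π ⟨$⟩ʳ zero) (E.from (remove zero π))

  from-cong : ∀ {π ρ} → π ≈ₚ ρ → from π ≡ from ρ
  from-cong {π} {ρ} π≈ρ = cong₂ combine (π≈ρ zero) (E.from-cong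
    (remove-unique zero π (remove zero ρ) λ l →
      trans (π≈ρ (suc l)) (trans (punchIn-permute ρ zero l)
        (cong (λ j → punchIn j (remove zero ρ ⟨$⟩ʳ l)) (sym (π≈ρ zero))))))

  to-from : ∀ π → to (from π) ≈ₚ π
  to-from π l =
    trans (cong (λ q → build q ⟨$⟩ʳ l) (remQuot-combine (π ⟨$⟩ʳ zero) (E.from (remove zero π))))
    (trans (insert-cong zero (π ⟨$⟩ʳ zero) (E.strictlyInverseˡ (remove zero π)) l)
           (insert-remove zero π l))

  from-build : ∀ j i → from (build (j , i)) ≡ combine j i
  from-build j i = cong₂ combine (insert-self zero j (E.to i))
    (trans (E.from-cong (remove-unique zero (build (j , i)) (E.to i) λ l →
       trans (insert-punchIn zero j (E.to i) l)
             (cong (λ j′ → punchIn j′ (E.to i ⟨$⟩ʳ l)) (sym (insert-self zero j (E.to i))))))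
     (E.strictlyInverseʳ i))

  from-to : ∀ i → from (to i) ≡ i
  from-to i = trans (uncurry from-build (remQuot k i)) (combine-remQuot {suc m} k i)

-- With Fin (suc n) for {1,…,n+1}, `fromℕ n` is the element n+1.
τ : ∀ {n} → Fin n → Permutation′ (suc n)
τ {n} i = transpose (inject₁ i) (fromℕ n)

private
  transpose-comm : ∀ {m} (i j k : Fin m) → Components.transpose i j k ≡ Components.transpose j i k
  transpose-comm i j k with k ≟ i in k≟i | k ≟ j in k≟j
  ... | yes k≡i | yes k≡j             = trans (sym k≡j) k≡i
  ... | yes _   | no  _   rewrite k≟i = refl
  ... | no  _   | yes _   rewrite k≟j = refl
  ... | no  _   | no  _   rewrite k≟i | k≟j = refl

  transpose-first : ∀ {m} (i j : Fin m) → Components.transpose i j i ≡ j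
  transpose-first i j with i ≟ i
  ... | yes _   = refl
  ... | no  i≢i = contradiction refl i≢i

star : ∀ n → ConnectionSet (𝔖 (suc n))
star n = record
  { S         = λ σ → ∃ λ i → σ ≈ τ i
  ; S-resp    = λ { {s} {t} s≈t (i , e) → i , G.trans {t} {s} {τ i} (G.sym {s} {t} s≈t) e }
  ; ⁻¹-closed = λ { {s} (i , e) → i , λ k →
                    trans (G.⁻¹-cong {s} {τ i} e k) (transpose-comm (fromℕ n) (inject₁ i) k) }
  ; ε∉S       = λ { (i , e) → fromℕ≢inject₁ (sym (trans (e (inject₁ i)) (transpose-first (inject₁ i) (fromℕ n)))) }
  }
  where
  module G = Group (𝔖 (suc n))
  open G using (_≈_)

X[_] : ℕ → FiniteSimpleGraph
X[ n ] = Cay (𝔖 (suc n)) (𝔖-finite (suc n)) (star n)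

K : ℕ → FiniteSimpleGraph
K m = record
  { graph = record
    { vertices = setoid (Fin m)
    ; _~_      = _≢_
    ; ~-resp   = (λ { refl u≢v → u≢v }) , (λ { refl u≢v → u≢v })
    ; ~-sym    = ≢-sym
    }
  ; ~-irrefl = λ u≡v u≢v → u≢v u≡v
  ; finite   = m , Identity.inverse (setoid (Fin m))
  }

{-# OPTIONS --safe #-}
-- The covering map is evaluation at n+1, ξ ↦ ξ(n+1): the neighbours ξτᵢ of ξ
-- are sent to ξ(i), which are exactly the values other than ξ(n+1). The group
-- 𝔖ₙ, embedded as the stabiliser of n+1, acts on the right by g · ξ = ξg⁻¹.
-- Since gτᵢg⁻¹ = τ_{g(i)}, these are graph automorphisms, and the orbits are the
-- cosets of the stabiliser, that is, the fibres of evaluation at n+1.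
module Submission where

open import Defs
open import Algebra.Bundles using (Group)
open import Level using (0ℓ)
import Algebra.Morphism.Construct.Identity as IdentityMorphism
open import Data.Fin.Base using (Fin; zero; suc; inject₁; fromℕ; punchIn)
open import Data.Fin.Permutation
  using (Permutation′; _⟨$⟩ʳ_; _⟨$⟩ˡ_; inverseˡ; inverseʳ; _∘ₚ_; flip; transpose
        ; insert; remove; insert-punchIn; insert-remove)
  renaming (id to idₚ; _≈_ to _≈ₚ_)
import Data.Fin.Permutation.Components as Components
open import Data.Fin.Properties using (_≟_; fromℕ≢inject₁; inject₁-injective)
open import Data.Fin.Relation.Unary.Top using (view; ‵fromℕ; ‵inject₁)
open import Data.Nat.Base using (ℕ; suc; _≥_)
open import Data.Product.Base using (∃; _×_; _,_; proj₂)
open import Data.Sum.Base using (inj₁; inj₂)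
open import Function.Base using (id; _∘_)
open import Function.Bundles using (module Injection)
open import Function.Definitions using (Bijective)
open import Function.Properties.Inverse using (↔⇒↣)
open import Relation.Binary.Bundles using (Setoid)
open import Relation.Binary.PropositionalEquality
  using (_≡_; _≢_; refl; sym; trans; cong; cong₂; module ≡-Reasoning)
import Relation.Binary.Reasoning.Setoid as ≈-Reasoning
open import Relation.Nullary.Decidable using (yes; no; dec-true; dec-false)
open import Relation.Nullary.Negation using (contradiction)

-- Edges at a vertex and neighbours of that vertex.

module _ (X : Graph) where
  open Graph X
  open Edges X

  edgeSetoid : Setoid 0ℓ 0ℓ
  edgeSetoid = record
    { Carrier       = Edge
    ; _≈_           = _≈ₑ_
    ; isEquivalence = record
      { refl  = inj₁ (≈-refl , ≈-refl)
      ; sym   = λ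
        { (inj₁ (p , q)) → inj₁ (≈-sym p , ≈-sym q)
        ; (inj₂ (p , q)) → inj₂ (≈-sym q , ≈-sym p)
        }
      ; trans = λ
        { (inj₁ (p , q)) (inj₁ (r , s)) → inj₁ (≈-trans p r , ≈-trans q s)
        ; (inj₁ (p , q)) (inj₂ (r , s)) → inj₂ (≈-trans p r , ≈-trans q s)
        ; (inj₂ (p , q)) (inj₁ (r , s)) → inj₂ (≈-trans p s , ≈-trans q r)
        ; (inj₂ (p , q)) (inj₂ (r , s)) → inj₁ (≈-trans p s , ≈-trans q r)
        }
      }
    }

  -- An edge at `v` may list `v` as either end; reversing it when needed makes `v` the first, and
  -- `_≈ₑ_` ignores the reversal.
  incidentEdge-from : ∀ {v} ((e , _) : IncidentEdge v) → ∃ λ b → ∃ λ (v~b : v ~ b) → e ≈ₑ edge v b v~b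
  incidentEdge-from (edge a b a~b , inj₁ v≈a) =
    b , ~-resp .proj₂ (≈-sym v≈a) a~b , inj₁ (≈-sym v≈a , ≈-refl)
  incidentEdge-from (edge a b a~b , inj₂ v≈b) =
    a , ~-resp .proj₂ (≈-sym v≈b) (~-sym a~b) , inj₂ (≈-refl , ≈-sym v≈b)

module _ (X Y : FiniteSimpleGraph) where
  private
    module X = FiniteSimpleGraph X
    module Y = FiniteSimpleGraph Y
  open Edges using (edge; _≈ₑ_; _≈ᵢ_)

  -- Each edge at `v` is determined by its other end, so the bijection on incident edges reduces to
  -- one on neighbours.
  edge-bijection-from-neighbours : (p : GraphMorphism X.graph Y.graph) → let open GraphMorphism p in ∀ v →
    (∀ {a b} → v X.~ a → v X.~ b → to a Y.≈ to b → a X.≈ b) →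
    (∀ {w} → to v Y.~ w → ∃ λ b → v X.~ b × to b Y.≈ w) →
    Bijective (_≈ᵢ_ X.graph) (_≈ᵢ_ Y.graph) (mapIncident p v)
  edge-bijection-from-neighbours p v neighbours-inj neighbours-surj =
    (λ {e} {f} → injective e f) , surjective
    where
    open GraphMorphism p

    mapEdge : Edges.Edge X.graph → Edges.Edge Y.graph
    mapEdge (edge a b a~b) = edge (to a) (to b) (~-pres a~b)

    mapEdge-cong : ∀ e f → _≈ₑ_ X.graph e f → _≈ₑ_ Y.graph (mapEdge e) (mapEdge f)
    mapEdge-cong _ _ (inj₁ (q , r)) = inj₁ (to-cong q , to-cong r)
    mapEdge-cong _ _ (inj₂ (q , r)) = inj₂ (to-cong q , to-cong r)

    injective : ∀ e f → _≈ᵢ_ Y.graph (mapIncident p v e) (mapIncident p v f) → _≈ᵢ_ X.graph {v} e f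
    injective (e , v∈e) (f , v∈f) pe≈pf
      with incidentEdge-from X.graph (e , v∈e) | incidentEdge-from X.graph (f , v∈f)
    ... | b , v~b , e≈vb | d , v~d , f≈vd = begin
      e             ≈⟨ e≈vb ⟩
      edge v b v~b  ≈⟨ lift-edge pvb≈pvd ⟩
      edge v d v~d  ≈⟨ f≈vd ⟨
      f             ∎
      where
      pvb≈pvd : _≈ₑ_ Y.graph (mapEdge (edge v b v~b)) (mapEdge (edge v d v~d))
      pvb≈pvd = begin
        mapEdge (edge v b v~b)  ≈⟨ mapEdge-cong e (edge v b v~b) e≈vb ⟨
        mapEdge e               ≈⟨ pe≈pf ⟩
        mapEdge f               ≈⟨ mapEdge-cong f (edge v d v~d) f≈vd ⟩
        mapEdge (edge v d v~d)  ∎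
        where open ≈-Reasoning (edgeSetoid Y.graph)

      lift-edge : _≈ₑ_ Y.graph (mapEdge (edge v b v~b)) (mapEdge (edge v d v~d)) →
                  _≈ₑ_ X.graph (edge v b v~b) (edge v d v~d)
      lift-edge (inj₁ (_ , pb≈pd)) = inj₁ (X.≈-refl , neighbours-inj v~b v~d pb≈pd)
      -- A match with the ends swapped would make the edge from `to v` to `to d` a loop.
      lift-edge (inj₂ (pv≈pd , _)) = contradiction (~-pres v~d) (Y.~-irrefl pv≈pd)

      open ≈-Reasoning (edgeSetoid X.graph)

    surjective : ∀ y → ∃ λ x → ∀ {z} → _≈ᵢ_ X.graph {v} z x → _≈ᵢ_ Y.graph (mapIncident p v z) y
    surjective (f , pv∈f) with incidentEdge-from Y.graph (f , pv∈f)
    ... | w , pv~w , f≈pvw with neighbours-surj pv~w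
    ...   | b , v~b , pb≈w = (edge v b v~b , inj₁ X.≈-refl) , λ { {e , _} e≈vb → begin
      mapEdge e               ≈⟨ mapEdge-cong e (edge v b v~b) e≈vb ⟩
      mapEdge (edge v b v~b)  ≈⟨ inj₁ (Y.≈-refl , pb≈w) ⟩
      edge (to v) w pv~w      ≈⟨ f≈pvw ⟨
      f                       ∎ }
      where open ≈-Reasoning (edgeSetoid Y.graph)

-- Transpositions and their conjugates.

⟨$⟩ʳ-injective : ∀ {m} (π : Permutation′ m) {i j} → π ⟨$⟩ʳ i ≡ π ⟨$⟩ʳ j → i ≡ j
⟨$⟩ʳ-injective π = Injection.injective (↔⇒↣ π)

transpose-first : ∀ {m} (i j : Fin m) → Components.transpose i j i ≡ j
transpose-first i j rewrite dec-true (i ≟ i) refl = refl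

transpose-second : ∀ {m} (i j : Fin m) → Components.transpose i j j ≡ i
transpose-second i j with j ≟ i
... | yes j≡i = j≡i
... | no  _ rewrite dec-true (j ≟ j) refl = refl

-- This is π(i j)π⁻¹ = (π(i) π(j)) with the inverse cleared. As π is injective, testing `k` against
-- `i` and `j` gives the same answers after applying π.
transpose-conjugate : ∀ {m} (π : Permutation′ m) i j k →
  π ⟨$⟩ʳ Components.transpose i j k ≡ Components.transpose (π ⟨$⟩ʳ i) (π ⟨$⟩ʳ j) (π ⟨$⟩ʳ k)
transpose-conjugate π i j k with k ≟ i
... | yes refl = sym (transpose-first (π ⟨$⟩ʳ k) (π ⟨$⟩ʳ j))
... | no k≢i with k ≟ j
...   | yes refl = sym (transpose-second (π ⟨$⟩ʳ i) (π ⟨$⟩ʳ k))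
...   | no k≢j
        rewrite dec-false (π ⟨$⟩ʳ k ≟ π ⟨$⟩ʳ i) (k≢i ∘ ⟨$⟩ʳ-injective π)
              | dec-false (π ⟨$⟩ʳ k ≟ π ⟨$⟩ʳ j) (k≢j ∘ ⟨$⟩ʳ-injective π) = refl

-- Skipping the last index shifts nothing. This links the `punchIn` of `insert` to the `inject₁` of
-- `τ`.
punchIn-fromℕ : ∀ {n} (i : Fin n) → punchIn (fromℕ n) i ≡ inject₁ i
punchIn-fromℕ zero    = refl
punchIn-fromℕ (suc i) = cong suc (punchIn-fromℕ i)

-- The embedding of 𝔖ₙ as the stabiliser of n+1.

module _ {n : ℕ} where
  private
    top : Fin (suc n)
    top = fromℕ n

  extend : Permutation′ n → Permutation′ (suc n)
  extend = insert top top

  extend-fromℕ : ∀ π → extend π ⟨$⟩ʳ top ≡ top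
  extend-fromℕ π with top ≟ top
  ... | yes _   = refl
  ... | no  t≢t = contradiction refl t≢t

  extend-inject₁ : ∀ π i → extend π ⟨$⟩ʳ inject₁ i ≡ inject₁ (π ⟨$⟩ʳ i)
  extend-inject₁ π i = begin
    extend π ⟨$⟩ʳ inject₁ i      ≡⟨ cong (extend π ⟨$⟩ʳ_) (punchIn-fromℕ i) ⟨
    extend π ⟨$⟩ʳ punchIn top i  ≡⟨ insert-punchIn top top π i ⟩
    punchIn top (π ⟨$⟩ʳ i)       ≡⟨ punchIn-fromℕ (π ⟨$⟩ʳ i) ⟩
    inject₁ (π ⟨$⟩ʳ i)           ∎
    where open ≡-Reasoning

  extend-cong : ∀ {π ρ} → π ≈ₚ ρ → extend π ≈ₚ extend ρ
  extend-cong {π} {ρ} π≈ρ k with view k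
  ... | ‵fromℕ     = trans (extend-fromℕ π) (sym (extend-fromℕ ρ))
  ... | ‵inject₁ i = trans (extend-inject₁ π i) (trans (cong inject₁ (π≈ρ i)) (sym (extend-inject₁ ρ i)))

  extend-id : extend idₚ ≈ₚ idₚ
  extend-id k with view k
  ... | ‵fromℕ     = extend-fromℕ idₚ
  ... | ‵inject₁ i = extend-inject₁ idₚ i

  extend-∘ₚ : ∀ π ρ → extend (π ∘ₚ ρ) ≈ₚ extend π ∘ₚ extend ρ
  extend-∘ₚ π ρ k with view k
  ... | ‵fromℕ     = trans (extend-fromℕ (π ∘ₚ ρ))
                     (sym (trans (cong (extend ρ ⟨$⟩ʳ_) (extend-fromℕ π)) (extend-fromℕ ρ)))
  ... | ‵inject₁ i = trans (extend-inject₁ (π ∘ₚ ρ) i)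
                     (sym (trans (cong (extend ρ ⟨$⟩ʳ_) (extend-inject₁ π i)) (extend-inject₁ ρ (π ⟨$⟩ʳ i))))

  -- Hence `extend` reaches the whole stabiliser of `top`, which is what transitivity on fibres
  -- uses.
  extend-remove : ∀ ρ → ρ ⟨$⟩ʳ top ≡ top → extend (remove top ρ) ≈ₚ ρ
  extend-remove ρ ρ-top k =
    trans (cong (λ j → insert top j (remove top ρ) ⟨$⟩ʳ k) (sym ρ-top)) (insert-remove top ρ k)

  extend-τ : ∀ π i → τ i ∘ₚ extend π ≈ₚ extend π ∘ₚ τ (π ⟨$⟩ʳ i)
  extend-τ π i k = trans (transpose-conjugate (extend π) (inject₁ i) top k)
    (cong₂ (λ a b → Components.transpose a b (extend π ⟨$⟩ʳ k)) (extend-inject₁ π i) (extend-fromℕ π))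

  τ-fromℕ : ∀ (i : Fin n) → τ i ⟨$⟩ʳ top ≡ inject₁ i
  τ-fromℕ i = transpose-second (inject₁ i) top

  -- Neighbours in the star graph and the covering map.

  private
    module X = FiniteSimpleGraph X[ n ]
    module K = FiniteSimpleGraph (K (suc n))

  τ-neighbour : ∀ ξ i → ξ X.~ (τ i ∘ₚ ξ)
  τ-neighbour _ i = τ i , (i , λ _ → refl) , λ _ → refl

  neighbour-τ : ∀ ξ η → ξ X.~ η → ∃ λ i → η ≈ₚ τ i ∘ₚ ξ
  neighbour-τ ξ _ (s , (i , s≈τ) , η≈) = i , λ k → trans (η≈ k) (cong (ξ ⟨$⟩ʳ_) (s≈τ k))

  τ-neighbour-value : ∀ (ξ η : Permutation′ (suc n)) i → η ≈ₚ τ i ∘ₚ ξ → η ⟨$⟩ʳ top ≡ ξ ⟨$⟩ʳ inject₁ i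
  τ-neighbour-value ξ _ i η≈ = trans (η≈ top) (cong (ξ ⟨$⟩ʳ_) (τ-fromℕ i))

  evaluation : GraphMorphism X.graph K.graph
  evaluation = record
    { vertexMap = record { to = _⟨$⟩ʳ top ; cong = λ ξ≈η → ξ≈η top }
    ; ~-pres    = λ {ξ} {η} ξ~η ξ≡η → let i , η≈ = neighbour-τ ξ η ξ~η in
        fromℕ≢inject₁ (⟨$⟩ʳ-injective ξ (trans ξ≡η (τ-neighbour-value ξ η i η≈)))
    }

  -- The value of ξτᵢ at n+1 is ξ(i), and ξ is injective, so this value determines i.
  neighbours-injective : ∀ ξ {η ζ} → ξ X.~ η → ξ X.~ ζ → η ⟨$⟩ʳ top ≡ ζ ⟨$⟩ʳ top → η ≈ₚ ζ
  neighbours-injective ξ {η} {ζ} ξ~η ξ~ζ η≡ζ k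
    with neighbour-τ ξ η ξ~η | neighbour-τ ξ ζ ξ~ζ
  ... | i , η≈ | j , ζ≈ =
    trans (η≈ k) (trans (cong (λ l → ξ ⟨$⟩ʳ (τ l ⟨$⟩ʳ k)) i≡j) (sym (ζ≈ k)))
    where
    i≡j : i ≡ j
    i≡j = inject₁-injective (⟨$⟩ʳ-injective ξ
      (trans (sym (τ-neighbour-value ξ η i η≈)) (trans η≡ζ (τ-neighbour-value ξ ζ j ζ≈))))

  neighbours-surjective : ∀ ξ {w} → ξ ⟨$⟩ʳ top ≢ w → ∃ λ η → ξ X.~ η × η ⟨$⟩ʳ top ≡ w
  -- The required index is the position where ξ takes the value `w`; it is not `top`, by `ξ≢w`.
  neighbours-surjective ξ {w} ξ≢w with ξ ⟨$⟩ˡ w in eq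
  ... | x with view x
  ...   | ‵fromℕ     = contradiction (trans (cong (ξ ⟨$⟩ʳ_) (sym eq)) (inverseʳ ξ)) ξ≢w
  ...   | ‵inject₁ i = τ i ∘ₚ ξ , τ-neighbour ξ i ,
    trans (cong (ξ ⟨$⟩ʳ_) (trans (τ-fromℕ i) (sym eq))) (inverseʳ ξ)

  section : Fin (suc n) → Permutation′ (suc n)
  section w = transpose top w

  section-value : ∀ w → section w ⟨$⟩ʳ top ≡ w
  section-value = transpose-first top

  cover : Cover X[ n ] (K (suc n))
  cover = record
    { p              = evaluation
    ; p-surjective   = λ w → section w , λ η≈ → trans (η≈ top) (section-value w)
    ; edge-bijection = λ ξ → edge-bijection-from-neighbours X[ n ] (K (suc n)) evaluation ξ
        (λ {η} {ζ} → neighbours-injective ξ {η} {ζ}) (neighbours-surjective ξ)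
    }

  -- The action of 𝔖ₙ by graph automorphisms.

  infixr 8 _•_
  -- `_∘ₚ_` applies its left factor first, so this is ξg⁻¹; the inverse turns right multiplication
  -- into a left action.
  _•_ : Permutation′ n → Permutation′ (suc n) → Permutation′ (suc n)
  g • ξ = extend (flip g) ∘ₚ ξ

  •-congˡ : ∀ {g h} ξ → g ≈ₚ h → g • ξ ≈ₚ h • ξ
  •-congˡ {g} {h} ξ g≈h k =
    cong (ξ ⟨$⟩ʳ_) (extend-cong {flip g} {flip h} (Group.⁻¹-cong (𝔖 n) {g} {h} g≈h) k)

  •-identity : ∀ ξ → idₚ • ξ ≈ₚ ξ
  •-identity ξ k = cong (ξ ⟨$⟩ʳ_) (extend-id k)

  -- `h ∘ₚ g` is the product gh, and its `flip` acts definitionally as `flip g ∘ₚ flip h`.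
  •-assoc : ∀ g h ξ → (h ∘ₚ g) • ξ ≈ₚ g • (h • ξ)
  •-assoc g h ξ k = cong (ξ ⟨$⟩ʳ_) (extend-∘ₚ (flip g) (flip h) k)

  •-inverseˡ : ∀ g ξ → flip g • (g • ξ) ≈ₚ ξ
  •-inverseˡ g ξ k = trans (sym (•-assoc (flip g) g ξ k))
    (trans (•-congˡ {g ∘ₚ flip g} {idₚ} ξ (λ _ → inverseˡ g) k) (•-identity ξ k))

  •-inverseʳ : ∀ g ξ → g • (flip g • ξ) ≈ₚ ξ
  •-inverseʳ g ξ k = trans (sym (•-assoc g (flip g) ξ k))
    (trans (•-congˡ {flip g ∘ₚ g} {idₚ} ξ (λ _ → inverseʳ g) k) (•-identity ξ k))

  •-~-pres : ∀ g ξ η → ξ X.~ η → (g • ξ) X.~ (g • η)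
  •-~-pres g ξ η ξ~η with neighbour-τ ξ η ξ~η
  ... | i , η≈ = τ (g ⟨$⟩ʳ i) , (g ⟨$⟩ʳ i , λ _ → refl) , λ k → begin
    η ⟨$⟩ʳ (extend (flip g) ⟨$⟩ʳ k)
      ≡⟨ η≈ _ ⟩
    ξ ⟨$⟩ʳ (τ i ⟨$⟩ʳ (extend (flip g) ⟨$⟩ʳ k))
      -- Writing i as g⁻¹(g(i)) lets `extend-τ` be applied to g⁻¹ at the index g(i).
      ≡⟨ cong (λ j → ξ ⟨$⟩ʳ (τ j ⟨$⟩ʳ (extend (flip g) ⟨$⟩ʳ k))) (inverseˡ g) ⟨
    ξ ⟨$⟩ʳ (τ (g ⟨$⟩ˡ (g ⟨$⟩ʳ i)) ⟨$⟩ʳ (extend (flip g) ⟨$⟩ʳ k))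
      ≡⟨ cong (ξ ⟨$⟩ʳ_) (extend-τ (flip g) (g ⟨$⟩ʳ i) k) ⟨
    ξ ⟨$⟩ʳ (extend (flip g) ⟨$⟩ʳ (τ (g ⟨$⟩ʳ i) ⟨$⟩ʳ k))
      ∎
    where open ≡-Reasoning

  ~-resp-≈ₚ : ∀ {ξ ξ′ η η′} → ξ ≈ₚ ξ′ → η ≈ₚ η′ → ξ X.~ η → ξ′ X.~ η′
  ~-resp-≈ₚ {ξ} {ξ′} ξ≈ξ′ η≈η′ (s , s∈S , η≈) = s , s∈S , λ k →
    trans (sym (η≈η′ k)) (trans (η≈ k) (ξ≈ξ′ (s ⟨$⟩ʳ k)))

  action : GraphAction (𝔖 n) X.graph
  action = record
    { automorphism = λ g → record
      { vertexMap = record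
        { to        = g •_
        ; from      = flip g •_
        ; to-cong   = λ ξ≈η k → ξ≈η (extend (flip g) ⟨$⟩ʳ k)
        ; from-cong = λ ξ≈η k → ξ≈η (extend g ⟨$⟩ʳ k)
        ; inverse   = (λ {ξ} η≈ k → trans (η≈ (extend (flip g) ⟨$⟩ʳ k)) (•-inverseʳ g ξ k))
                    , (λ {ξ} η≈ k → trans (η≈ (extend g ⟨$⟩ʳ k)) (•-inverseˡ g ξ k))
        }
      ; ~-pres    = λ {ξ} {η} → •-~-pres g ξ η
      -- Acting by g⁻¹ preserves adjacency and cancels g.
      ; ~-reflect = λ {ξ} {η} gξ~gη →
          ~-resp-≈ₚ {flip g • (g • ξ)} {ξ} {flip g • (g • η)} {η} (•-inverseˡ g ξ) (•-inverseˡ g η)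
            (•-~-pres (flip g) (g • ξ) (g • η) gξ~gη)
      }
    ; ·-congˡ    = λ {g} {h} → •-congˡ {g} {h}
    ; ·-identity = •-identity
    ; ·-assoc    = •-assoc
    }

  -- Orbits as fibres, and the quotient graph.

  •-value : ∀ g ξ → (g • ξ) ⟨$⟩ʳ top ≡ ξ ⟨$⟩ʳ top
  •-value g ξ = cong (ξ ⟨$⟩ʳ_) (extend-fromℕ (flip g))

  -- Cancelling the injective ξ from ξg⁻¹ = ξ leaves g⁻¹ fixing every point.
  •-free : ∀ g ξ → g • ξ ≈ₚ ξ → g ≈ₚ idₚ
  •-free g ξ gξ≈ξ i = trans (cong (g ⟨$⟩ʳ_) (sym fixed)) (inverseʳ g)
    where
    fixed : g ⟨$⟩ˡ i ≡ i
    fixed = inject₁-injective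
      (trans (sym (extend-inject₁ (flip g) i)) (⟨$⟩ʳ-injective ξ (gξ≈ξ (inject₁ i))))

  •-transitive : ∀ ξ η → ξ ⟨$⟩ʳ top ≡ η ⟨$⟩ʳ top → ∃ λ g → g • ξ ≈ₚ η
  -- The equation ξg⁻¹ = η forces g⁻¹ = ξ⁻¹η. This fixes `top` because ξ and η agree there, so it
  -- restricts to the other n points.
  •-transitive ξ η ξ≡η = flip (remove top (η ∘ₚ flip ξ)) , λ k →
    trans (cong (ξ ⟨$⟩ʳ_) (extend-remove (η ∘ₚ flip ξ) fixes-top k)) (inverseʳ ξ)
    where
    fixes-top : ξ ⟨$⟩ˡ (η ⟨$⟩ʳ top) ≡ top
    fixes-top = trans (cong (ξ ⟨$⟩ˡ_) (sym ξ≡η)) (inverseˡ ξ)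

  sameOrbit⇒sameValue : ∀ {ξ η} → SameOrbit action ξ η → ξ ⟨$⟩ʳ top ≡ η ⟨$⟩ʳ top
  sameOrbit⇒sameValue {ξ} (g , gξ≈η) = trans (sym (•-value g ξ)) (gξ≈η top)

  quotient≅K : GraphIsomorphism (quotient action) K.graph
  quotient≅K = record
    { vertexMap = record
      { to        = _⟨$⟩ʳ top
      ; from      = section
      ; to-cong   = λ {ξ} {η} → sameOrbit⇒sameValue {ξ} {η}
      ; from-cong = λ { {w} refl → •-transitive (section w) (section w) refl }
      ; inverse   = (λ {w} {ξ} o → trans (sameOrbit⇒sameValue {ξ} {section w} o) (section-value w))
                  , (λ { {ξ} refl → •-transitive (section (ξ ⟨$⟩ʳ top)) ξ (section-value (ξ ⟨$⟩ʳ top)) })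
      }
    ; ~-pres    = λ { {ξ} {η} (ξ′ , η′ , o , o′ , ξ′~η′) ξ≡η →
        GraphMorphism.~-pres evaluation {ξ′} {η′} ξ′~η′
          (trans (sym (sameOrbit⇒sameValue {ξ} {ξ′} o)) (trans ξ≡η (sameOrbit⇒sameValue {η} {η′} o′))) }
    -- ξ has a neighbour ζ whose value is that of η; ζ lies in the orbit of η, so ξ and ζ are
    -- adjacent representatives.
    ; ~-reflect = λ {ξ} {η} ξ≢η → let ζ , ξ~ζ , ζ≡η = neighbours-surjective ξ ξ≢η in
        ξ , ζ , •-transitive ξ ξ refl , •-transitive η ζ (sym ζ≡η) , ξ~ζ
    }

  galoisAction : GaloisAction cover (𝔖 n)
  galoisAction = record
    { action           = action
    ; preserves-fibers = λ _ g ξ ξ∈w → trans (•-value g ξ) ξ∈w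
    ; free             = λ _ g ξ _ → •-free g ξ
    ; transitive       = λ _ ξ η ξ∈w η∈w → •-transitive ξ η (trans ξ∈w (sym η∈w))
    ; quotient≅X       = quotient≅K
    }

theorem1 : (n : ℕ) → n ≥ 1 → X[ n ] IsA (𝔖 n) -CoverOf (K (suc n))
theorem1 n _ =
  record { cover = cover ; galoisGroup = 𝔖 n ; galoisAction = galoisAction } ,
  id , IdentityMorphism.isGroupIsomorphism (Group.rawGroup (𝔖 n)) (λ {π} → Group.refl (𝔖 n) {π})
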